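{- There is an absolute constant $K>0$ such that for every $n\ge 1$, every $f:\{0,1\}^n\to\{0,1\}$, every $\epsilon\in[0,1/2)$ and every product distribution $\mu$ on $\{0,1\}^n$, $$D^{\mu}_{4\epsilon}(f)\le K\cdot \mathrm{corr}^{\times}_{\min,\epsilon}(f)\cdot \mathrm{bs}(f).$$
   Context: Let $f:\{0,1\}^n\to\{0,1\}$ and $[n]=\{1,\dots,n\}$. Distributional query complexity: for a probability distribution $\mu$ on $\{0,1\}^n$ and $\delta\ge 0$, $D^\mu_\delta(f)$ is the minimum, over deterministic query algorithms (decision trees) $\mathcal A$ with $\Pr_{x\sim\mu}[\mathcal A(x)=f(x)]\ge 1-\delta$, of the worst-case (over inputs $x$) number of queried bits of $x$. A product distribution on $\{0,1\}^n$ is a distribution of the form $\mu(x)=\prod_{i\in[n]}\mu_i(x_i)$ with $\mu_i:\{0,1\}\to[0,1]$, $\mu_i(0)+\mu_i(1)=1$. Block sensitivity: for $S\subseteq[n]$, $x^S$ is $x$ with the bits in $S$ flipped. $\mathrm{bs}(f,x)$ is the maximum $k$ such that there are disjoint $B_1,\dots,B_k\subseteq[n]$ with $f(x)\ne f(x^{B_i})$ for all $i$; $\mathrm{bs}(f)=\max_x \mathrm{bs}(f,x)$. Assignments: an assignment is a map $A:[n]\to\{0,1,*\}$, identified with the subcube $\{x: \forall i,\ x_i=A(i)\text{ or }A(i)=*\}$; $|A|=|\{i:A(i)\ne *\}|$ is its co-dimension. Corruption: for a distribution $\mu$ on $\{0,1\}^n$, $\epsilon\geq 0$ and $b\in\{0,1\}$,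 an assignment $A$ is an $\epsilon$-error $b$-certificate under $\mu$ if $\Pr_{x\sim\mu}[x\in A]>0$ and $\Pr_{x\sim\mu}[f(x)\ne b\mid x\in A]\le\epsilon$. Let $\mathrm{corr}^{b,\mu}_\epsilon(f)$ be the minimum of $|A|$ over $\epsilon$-error $b$-certificates $A$ under $\mu$ ($+\infty$ if there is none). The minimum query corruption bound for product distributions is $\mathrm{corr}^{\times}_{\min,\epsilon}(f)=\max_\mu\min_{b\in\{0,1\}}\mathrm{corr}^{b,\mu}_\epsilon(f)$, with $\mu$ ranging over all product distributions on $\{0,1\}^n$ (the inner minimum is always finite). -}

module Defs where

open import Level using (Level; _⊔_; suc)
open import Algebra.Apartness.Bundles using (HeytingField; HeytingCommutativeRing)
open import Algebra.Bundles using (CommutativeRing)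
import Algebra.Definitions.RawMonoid as RawMonoidDefinitions
open import Data.Bool using (Bool; true; false; not; _∧_; _xor_; if_then_else_; T?; _≟_)
open import Data.Fin using (Fin)
open import Data.Fin.Subset using (Subset; Empty; _∩_)
open import Data.Maybe using (Maybe; just; nothing; is-just)
open import Data.Nat as ℕ using (ℕ)
open import Data.Product using (_×_; Σ-syntax; ∃-syntax; proj₁)
open import Data.Sum using (_⊎_)
open import Data.Vec using (Vec; []; _∷_; lookup; zipWith; count)
open import Function using (_∘_)
open import Relation.Binary using (Rel; IsStrictPartialOrder)
open import Relation.Binary.PropositionalEquality using (_≡_; _≢_)
open import Relation.Nullary using (¬_; does)

private
  variable
    ℓ : Level
    n : ℕ

-- Quantities given by a minimum or a maximum are stated relationally, as
-- "m is the minimum (maximum) of P": the predicates P below need not be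
-- decidable.

IsMin IsMax : (ℕ → Set ℓ) → ℕ → Set ℓ
IsMin P m = P m × (∀ k → P k → m ℕ.≤ k)
IsMax P m = P m × (∀ k → P k → k ℕ.≤ m)

-- The standard library has no real numbers, so probabilities live in an
-- arbitrary ordered field.  Classically these are the linearly ordered fields,
-- ℝ among them; since the order is not assumed to be decidable, constructive
-- (Cauchy or Dedekind) reals are instances too.

record OrderedField c ℓ₁ ℓ₂ : Set (suc (c ⊔ ℓ₁ ⊔ ℓ₂)) where
  infix  4 _<_ _≤_
  field
    heytingField : HeytingField c ℓ₁ ℓ₂

  open HeytingField heytingField public

  field
    _<_                  : Rel Carrier ℓ₂
    isStrictPartialOrder : IsStrictPartialOrder _≈_ _<_
    <⇒#                  : ∀ {x y} → x < y → x # y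
    #⇒<⊎>                : ∀ {x y} → x # y → x < y ⊎ y < x
    +-monoʳ-<            : ∀ x {y z} → y < z → x + y < x + z
    *-pos                : ∀ {x y} → 0# < x → 0# < y → 0# < x * y

  _≤_ : Rel Carrier ℓ₂
  x ≤ y = ¬ (y < x)

  -- #⇒invertible yields an inverse of x - 0#.
  recip : ∀ {x} → 0# < x → Carrier
  recip 0<x = proj₁ (#⇒invertible (#-sym (<⇒# 0<x)))

  commutativeRing : CommutativeRing c ℓ₁
  commutativeRing = HeytingCommutativeRing.commutativeRing heytingCommutativeRing

  open CommutativeRing commutativeRing public using (+-rawMonoid; *-rawMonoid)

  open RawMonoidDefinitions +-rawMonoid public using () renaming (_×_ to infixr 8 _·_)
  open RawMonoidDefinitions *-rawMonoid public using () renaming (sum to ∏)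

BoolFun : ℕ → Set
BoolFun n = Vec Bool n → Bool

flipOn : Subset n → Vec Bool n → Vec Bool n
flipOn S x = zipWith _xor_ S x

SensitiveBlocks : BoolFun n → Vec Bool n → ℕ → Set
SensitiveBlocks {n} f x k =
  Σ[ B ∈ (Fin k → Subset n) ]
    (∀ i j → i ≢ j → Empty (B i ∩ B j)) ×
    (∀ i → f x ≢ f (flipOn (B i) x))

IsBsAt : BoolFun n → Vec Bool n → ℕ → Set
IsBsAt f x = IsMax (SensitiveBlocks f x)

IsBs : BoolFun n → ℕ → Set
IsBs f = IsMax (λ k → ∃[ x ] IsBsAt f x k)

data DecisionTree (n : ℕ) : Set where
  leaf  : Bool → DecisionTree n
  query : Fin n → (if0 if1 : DecisionTree n) → DecisionTree n

eval : DecisionTree n → BoolFun n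
eval (leaf b)          x = b
eval (query i if0 if1) x = if lookup x i then eval if1 x else eval if0 x

queries : DecisionTree n → Vec Bool n → ℕ
queries (leaf b)          x = 0
queries (query i if0 if1) x =
  ℕ.suc (if lookup x i then queries if1 x else queries if0 x)

IsCost : DecisionTree n → ℕ → Set
IsCost t = IsMax (λ k → ∃[ x ] queries t x ≡ k)

-- nothing plays the role of the symbol *.
Assignment : ℕ → Set
Assignment n = Vec (Maybe Bool) n

codim : Assignment n → ℕ
codim = count (T? ∘ is-just)

subcube : Assignment n → BoolFun n
subcube []             []       = true
subcube (nothing ∷ A) (_ ∷ x) = subcube A x
subcube (just b  ∷ A) (y ∷ x) = does (y ≟ b) ∧ subcube A x

module Queries {c ℓ₁ ℓ₂} (F : OrderedField c ℓ₁ ℓ₂) where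
  open OrderedField F

  ∑ : (Vec Bool n → Carrier) → Carrier
  ∑ {ℕ.zero}  g = g []
  ∑ {ℕ.suc n} g = ∑ (λ x → g (false ∷ x)) + ∑ (λ x → g (true ∷ x))

  record Distribution (n : ℕ) : Set (c ⊔ ℓ₁ ⊔ ℓ₂) where
    field
      mass        : Vec Bool n → Carrier
      mass-nonneg : ∀ x → 0# ≤ mass x
      mass-total  : ∑ mass ≈ 1#

  open Distribution public

  IsProduct : Distribution n → Set (c ⊔ ℓ₁ ⊔ ℓ₂)
  IsProduct {n} μ =
    Σ[ m ∈ (Fin n → Bool → Carrier) ]
      (∀ i b → 0# ≤ m i b × m i b ≤ 1#) ×
      (∀ i → m i false + m i true ≈ 1#) ×
      (∀ x → mass μ x ≈ ∏ (λ i → m i (lookup x i)))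

  Pr : Distribution n → BoolFun n → Carrier
  Pr μ E = ∑ (λ x → if E x then mass μ x else 0#)

  condPr : (μ : Distribution n) (E C : BoolFun n) → 0# < Pr μ C → Carrier
  condPr μ E C 0<PrC = Pr μ (λ x → E x ∧ C x) * recip 0<PrC

  Computes : Distribution n → Carrier → BoolFun n → DecisionTree n → Set ℓ₂
  Computes μ δ f t = 1# - δ ≤ Pr μ (λ x → does (eval t x ≟ f x))

  IsD : Distribution n → Carrier → BoolFun n → ℕ → Set ℓ₂
  IsD μ δ f = IsMin (λ k → ∃[ t ] Computes μ δ f t × IsCost t k)

  IsCertificate : Bool → Distribution n → Carrier → BoolFun n → Assignment n → Set ℓ₂
  IsCertificate b μ ε f A =
    Σ[ 0<PrA ∈ 0# < Pr μ (subcube A) ]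
      condPr μ (λ x → not (does (f x ≟ b))) (subcube A) 0<PrA ≤ ε

  -- No value of k satisfies this when there is no certificate (corr = +∞).
  IsCorr : Bool → Distribution n → Carrier → BoolFun n → ℕ → Set ℓ₂
  IsCorr b μ ε f = IsMin (λ k → ∃[ A ] IsCertificate b μ ε f A × codim A ≡ k)

  IsMinCorr : Distribution n → Carrier → BoolFun n → ℕ → Set ℓ₂
  IsMinCorr μ ε f = IsMin (λ k → ∃[ b ] IsCorr b μ ε f k)

  IsCorr× : Carrier → BoolFun n → ℕ → Set (c ⊔ ℓ₁ ⊔ ℓ₂)
  IsCorr× {n} ε f =
    IsMax (λ k → Σ[ μ ∈ Distribution n ] IsProduct μ × IsMinCorr μ ε f k)

{-# OPTIONS --safe #-}
-- Put b = bs(f).  A decision tree runs 4b rounds.  When it has seen the bits ρ,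
-- it takes an ε-error certificate A of a bit v under μ conditioned on ρ (again
-- a product distribution, so |A| ≤ corr), reads the bits in dom A and counts a
-- vote for v; it outputs the majority vote.  Replacing the bits of x in dom A by
-- A turns the conditional distribution given ρ into the one given ρ and A, so
-- each round is misled, that is f(override A x) ≠ v, with probability at most ε.
-- A vote against f(x) that is not misled yields a sensitive block of x, made of
-- bits not read before, so there are at most b such votes.  A wrong output thus
-- means at least 2b - b = b misled rounds; by Markov's inequality this has
-- probability at most 4bε / b = 4ε.  Since the order of the field is undecidable,
-- certificates exist only up to double negation, which suffices as d ≤ K corr b
-- is decidable.

module Submission where

open import Defs
import Algebra.Apartness.Properties.HeytingCommutativeRing as HeytingProperties
open import Algebra.Bundles using (CommutativeRing)
import Algebra.Properties.Ring as RingProperties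
import Algebra.Properties.Semiring.Mult as Multiples
import Algebra.Solver.Ring.NaturalCoefficients.Default as RingSolver
open import Data.Bool using (Bool; true; false; not; _∧_; _xor_; if_then_else_; T; _≟_)
open import Data.Bool.Properties using (not-¬; xor-same)
open import Data.Empty using (⊥)
open import Data.Fin as Fin using (Fin; zero; suc)
open import Data.Fin.Properties using (injective⇒≤)
open import Data.Fin.Subset using (Subset; Empty; _∩_; _∈_)
open import Data.Fin.Subset.Properties using (x∈p∩q⁺; x∈p∩q⁻; nonempty?; Empty-unique)
open import Data.List as List using (List; []; _∷_)
open import Data.List.Membership.Propositional using () renaming (_∈_ to _∈ₗ_)
open import Data.List.Membership.Propositional.Properties using (∈-map⁺)
open import Data.List.Properties using (length-map)
open import Data.List.Relation.Unary.Any using (here; there)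
open import Data.Maybe using (Maybe; just; nothing; fromMaybe)
open import Data.Nat as ℕ using (ℕ; zero; suc; z≤n; s≤s)
open import Data.Nat.Induction using (<-rec)
import Data.Nat.Properties as ℕₚ
open import Data.Product using (_×_; _,_; ∃-syntax; Σ-syntax; proj₁; proj₂)
open import Data.Sum using (_⊎_; inj₁; inj₂)
open import Data.Vec using (Vec; []; _∷_; lookup; zipWith; map; _[_]≔_; replicate)
import Data.Vec.Functional as Vector
open import Data.Vec.Properties
  using (lookup-replicate; lookup-zipWith; lookup∘update; lookup∘update′; []=⇒lookup)
open import Function using (_∘_)
open import Level using (Level)
open import Relation.Binary using (Poset; IsStrictPartialOrder)
open import Relation.Binary.PropositionalEquality
  using (_≡_; _≢_; refl; sym; trans; cong; cong₂; subst; module ≡-Reasoning)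
import Relation.Binary.Reasoning.PartialOrder as ≤-Reasoning
import Relation.Binary.Reasoning.Setoid as ≈-Reasoning
open import Relation.Nullary using (¬_; yes; no; does; contradiction)
open import Relation.Nullary.Decidable using (decidable-stable)

private
  variable
    ℓ : Level
    n : ℕ

-- Extrema and finite choice up to double negation.

-- If no minimum existed, strong induction would refute `P k` for every `k`.
¬¬-min : (P : ℕ → Set ℓ) → ∀ {k} → P k → ¬ ¬ (∃[ m ] IsMin P m)
¬¬-min P Pk ¬min = <-rec (λ k → ¬ P k) step _ Pk
  where
  step : ∀ k → (∀ {j} → j ℕ.< k → ¬ P j) → ¬ P k
  step k none-below Pk =
    ¬min (k , Pk , λ j Pj → ℕₚ.≮⇒≥ (λ j<k → none-below j<k Pj))

-- Reflecting `k` to `N ∸ k` turns the largest element below the bound into a least distance from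
-- it.
¬¬-max : (P : ℕ → Set ℓ) → ∀ {N} → (∀ k → P k → k ℕ.≤ N) →
         ∀ {k} → P k → ¬ ¬ (∃[ m ] IsMax P m)
¬¬-max P {N} bound {k} Pk ¬max =
  ¬¬-min (λ d → P (N ℕ.∸ d)) {N ℕ.∸ k} (reflect Pk) λ (d , Pd , least) →
    ¬max (N ℕ.∸ d , Pd , λ j Pj →
      subst (ℕ._≤ _) (ℕₚ.m∸[m∸n]≡n (bound j Pj))
        (ℕₚ.∸-monoʳ-≤ N (least (N ℕ.∸ j) (reflect Pj))))
  where
  reflect : ∀ {j} → P j → P (N ℕ.∸ (N ℕ.∸ j))
  reflect {j} Pj = subst P (sym (ℕₚ.m∸[m∸n]≡n (bound j Pj))) Pj

-- There are only finitely many assignments, three continuations per coordinate, so double negation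
-- passes through the product over all of them.
¬¬-choice : {P : Assignment n → Set ℓ} → (∀ ρ → ¬ ¬ P ρ) → ¬ ¬ (∀ ρ → P ρ)
¬¬-choice {n = zero}  h k = h [] λ p → k λ { [] → p }
¬¬-choice {n = suc n} h k =
  ¬¬-choice (h ∘ (nothing ∷_)) λ p →
  ¬¬-choice (h ∘ (just false ∷_)) λ q →
  ¬¬-choice (h ∘ (just true ∷_)) λ r →
  k λ { (nothing ∷ ρ) → p ρ ; (just false ∷ ρ) → q ρ ; (just true ∷ ρ) → r ρ }

-- Sensitive blocks and block sensitivity.

-- Turns any change of input into a block flip: the block is the set of positions where the two
-- inputs differ.
flipOn-xor : (x y : Vec Bool n) → flipOn (zipWith _xor_ x y) x ≡ y
flipOn-xor []       []       = refl
flipOn-xor (a ∷ x) (b ∷ y) = cong₂ _∷_ (xor-xor a b) (flipOn-xor x y)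
  where
  xor-xor : ∀ a b → (a xor b) xor a ≡ b
  xor-xor false false = refl
  xor-xor false true  = refl
  xor-xor true  false = refl
  xor-xor true  true  = refl

∈-xor⇒≢ : ∀ {x y : Vec Bool n} {i} → i ∈ zipWith _xor_ x y → lookup x i ≢ lookup y i
∈-xor⇒≢ {x = x} {y} {i} i∈B xᵢ≡yᵢ = contradiction true≡false λ ()
  where
  open ≡-Reasoning
  true≡false : true ≡ false
  true≡false = begin
    true                          ≡⟨ []=⇒lookup i∈B ⟨
    lookup (zipWith _xor_ x y) i  ≡⟨ lookup-zipWith _xor_ i x y ⟩
    lookup x i xor lookup y i     ≡⟨ cong (_xor lookup y i) xᵢ≡yᵢ ⟩
    lookup y i xor lookup y i     ≡⟨ xor-same (lookup y i) ⟩
    false                         ∎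

flipOn-empty : (S : Subset n) (x : Vec Bool n) → Empty S → flipOn S x ≡ x
flipOn-empty S x ∅ rewrite Empty-unique ∅ = helper x
  where
  helper : ∀ {n} (x : Vec Bool n) → flipOn (replicate n false) x ≡ x
  helper []       = refl
  helper (a ∷ x) = cong (a ∷_) (helper x)

-- A sensitive block is nonempty, and points picked from disjoint blocks are distinct. This is the
-- bound that `¬¬-max` asks for.
sensitiveBlocks-≤ : (f : BoolFun n) (x : Vec Bool n) → ∀ k → SensitiveBlocks f x k → k ℕ.≤ n
sensitiveBlocks-≤ f x k (B , disjoint , sensitive) = injective⇒≤ {f = point} injective
  where
  pick : ∀ j → ∃[ i ] i ∈ B j
  pick j with nonempty? (B j)
  ... | yes i∈Bj = i∈Bj
  ... | no  ∅    = contradiction (cong f (sym (flipOn-empty (B j) x ∅))) (sensitive j)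

  point = proj₁ ∘ pick

  injective : ∀ {i j} → point i ≡ point j → i ≡ j
  injective {i} {j} pᵢ≡pⱼ with i Fin.≟ j
  ... | yes i≡j = i≡j
  ... | no  i≢j = contradiction
    (point i , x∈p∩q⁺ (proj₂ (pick i) , subst (_∈ B j) (sym pᵢ≡pⱼ) (proj₂ (pick j))))
    (disjoint i j i≢j)

-- `IsBs` speaks only of local maxima that are attained, so the local maximum at `x` is produced
-- first; double negation suffices because `≤` on ℕ is decidable.
sensitiveBlocks-≤-bs : ∀ {f : BoolFun n} {bs} → IsBs f bs →
                       ∀ {x k} → SensitiveBlocks f x k → k ℕ.≤ bs
sensitiveBlocks-≤-bs {f = f} (_ , max) {x} {k} B = decidable-stable (k ℕ.≤? _) λ k≰bs →
  ¬¬-max (SensitiveBlocks f x) (sensitiveBlocks-≤ f x) B λ (m , isMax) →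
    k≰bs (ℕₚ.≤-trans (proj₂ isMax k B) (max m (x , isMax)))

bs≡0⇒constant : ∀ {f : BoolFun n} → IsBs f 0 → ∀ x y → f x ≡ f y
bs≡0⇒constant {f = f} isBs x y = decidable-stable (f x ≟ f y) λ fx≢fy →
  contradiction (sensitiveBlocks-≤-bs isBs (block fx≢fy)) λ ()
  where
  block : f x ≢ f y → SensitiveBlocks f x 1
  block fx≢fy =
      (λ _ → zipWith _xor_ x y)
    , (λ { zero zero 0≢0 → contradiction refl 0≢0 })
    , (λ _ → subst (λ z → f x ≢ f z) (sym (flipOn-xor x y)) fx≢fy)

-- Partial assignments and trees that read a list of bits.

override : Assignment n → Vec Bool n → Vec Bool n
override = zipWith (λ a b → fromMaybe b a)

dom : Assignment n → List (Fin n)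
dom []             = []
dom (nothing ∷ A) = List.map suc (dom A)
dom (just _  ∷ A) = zero ∷ List.map suc (dom A)

length-dom : (A : Assignment n) → List.length (dom A) ≡ codim A
length-dom []             = refl
length-dom (nothing ∷ A) = trans (length-map suc (dom A)) (length-dom A)
length-dom (just _  ∷ A) = cong suc (trans (length-map suc (dom A)) (length-dom A))

∈-dom : ∀ (A : Assignment n) {i c} → lookup A i ≡ just c → i ∈ₗ dom A
∈-dom (just _  ∷ A) {zero}  eq = here refl
∈-dom (nothing ∷ A) {suc i} eq = ∈-map⁺ suc (∈-dom A eq)
∈-dom (just _  ∷ A) {suc i} eq = there (∈-map⁺ suc (∈-dom A eq))

Agrees : Assignment n → Vec Bool n → Set
Agrees ρ x = ∀ i {c} → lookup ρ i ≡ just c → lookup x i ≡ c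

Compatible : Assignment n → Assignment n → Set
Compatible ρ A = ∀ i {c d} → lookup ρ i ≡ just c → lookup A i ≡ just d → c ≡ d

reveal : List (Fin n) → Vec Bool n → Assignment n → Assignment n
reveal []       x ρ = ρ
reveal (i ∷ is) x ρ = reveal is x (ρ [ i ]≔ just (lookup x i))

reveal-agrees : ∀ is {x : Vec Bool n} {ρ} → Agrees ρ x → Agrees (reveal is x ρ) x
reveal-agrees []       agrees = agrees
reveal-agrees (i ∷ is) {x} {ρ} agrees = reveal-agrees is agrees′
  where
  agrees′ : Agrees (ρ [ i ]≔ just (lookup x i)) x
  agrees′ j eq with j Fin.≟ i
  ... | no j≢i   = agrees j (trans (sym (lookup∘update′ j≢i ρ _)) eq)
  ... | yes refl with refl ← trans (sym (lookup∘update i ρ _)) eq = refl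

reveal-nothing : ∀ is {x : Vec Bool n} {ρ i} → lookup (reveal is x ρ) i ≡ nothing →
                 lookup ρ i ≡ nothing × ¬ (i ∈ₗ is)
reveal-nothing []       eq = eq , λ ()
reveal-nothing (j ∷ is) {x} {ρ} {i} eq with reveal-nothing is eq
... | eq′ , i∉is with i Fin.≟ j
...   | yes refl = contradiction (trans (sym (lookup∘update i ρ _)) eq′) λ ()
...   | no  i≢j  = trans (sym (lookup∘update′ i≢j ρ _)) eq′ ,
                   λ { (here i≡j) → i≢j i≡j ; (there i∈is) → i∉is i∈is }

-- The continuation receives the enlarged assignment. Bits already in `ρ` are queried again, so the
-- cost is exactly the length of the list.
queryAll : List (Fin n) → (Assignment n → DecisionTree n) → Assignment n → DecisionTree n
queryAll []       k ρ = k ρ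
queryAll (i ∷ is) k ρ =
  query i (queryAll is k (ρ [ i ]≔ just false)) (queryAll is k (ρ [ i ]≔ just true))

eval-queryAll : ∀ is (k : Assignment n → DecisionTree n) ρ x →
                eval (queryAll is k ρ) x ≡ eval (k (reveal is x ρ)) x
eval-queryAll []       k ρ x = refl
eval-queryAll (i ∷ is) k ρ x with lookup x i
... | false = eval-queryAll is k (ρ [ i ]≔ just false) x
... | true  = eval-queryAll is k (ρ [ i ]≔ just true) x

queries-queryAll : ∀ is (k : Assignment n → DecisionTree n) ρ x →
                   queries (queryAll is k ρ) x ≡ List.length is ℕ.+ queries (k (reveal is x ρ)) x
queries-queryAll []       k ρ x = refl
queries-queryAll (i ∷ is) k ρ x with lookup x i
... | false = cong suc (queries-queryAll is k (ρ [ i ]≔ just false) x)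
... | true  = cong suc (queries-queryAll is k (ρ [ i ]≔ just true) x)

-- Majority votes.

Votes : Set
Votes = Bool → ℕ

addVote : Bool → Votes → Votes
addVote b v c = if does (b ≟ c) then suc (v c) else v c

majority : Votes → Bool
majority v = v false ℕ.≤ᵇ v true

-- A wrong winner holds at least half of the votes. The inequality is weak because a tie goes to
-- `true`.
majority-wrong : ∀ v {c} → majority v ≢ c → v true ℕ.+ v false ℕ.≤ v (not c) ℕ.+ v (not c)
majority-wrong v {true}  wrong =
  ℕₚ.+-monoˡ-≤ (v false) (ℕₚ.<⇒≤ (ℕₚ.≰⇒> λ le → wrong (T⇒≡ (ℕₚ.≤⇒≤ᵇ le))))
  where
  T⇒≡ : ∀ {b} → T b → b ≡ true
  T⇒≡ {true} _ = refl
majority-wrong v {false} wrong =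
  ℕₚ.+-monoʳ-≤ (v true) (ℕₚ.≤ᵇ⇒≤ _ _ (≢false⇒T wrong))
  where
  ≢false⇒T : ∀ {b} → b ≢ false → T b
  ≢false⇒T {true}  _ = _
  ≢false⇒T {false} ≢ = contradiction refl ≢

-- The voting protocol and its combinatorial analysis.

module Protocol (f : BoolFun n) (cert : Assignment n → Assignment n) (vote : Assignment n → Bool) where

  next : Assignment n → Vec Bool n → Assignment n
  next ρ x = reveal (dom (cert ρ)) x ρ

  protocol : ℕ → Votes → Assignment n → DecisionTree n
  protocol zero    v ρ = leaf (majority v)
  protocol (suc s) v ρ = queryAll (dom (cert ρ)) (protocol s (addVote (vote ρ) v)) ρ

  tally : ℕ → Votes → Assignment n → Vec Bool n → Votes
  tally zero    v ρ x = v
  tally (suc s) v ρ x = tally s (addVote (vote ρ) v) (next ρ x) x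

  -- Tested at the overridden point rather than at `x`, so that its mean given `ρ` is the error of
  -- the certificate, whatever bits are then read.
  misled : Assignment n → Vec Bool n → ℕ
  misled ρ x = if does (f (override (cert ρ) x) ≟ vote ρ) then 0 else 1

  misleds : ℕ → Assignment n → Vec Bool n → ℕ
  misleds zero    ρ x = 0
  misleds (suc s) ρ x = misled ρ x ℕ.+ misleds s (next ρ x) x

  eval-protocol : ∀ s v ρ x → eval (protocol s v ρ) x ≡ majority (tally s v ρ x)
  eval-protocol zero    v ρ x = refl
  eval-protocol (suc s) v ρ x =
    trans (eval-queryAll (dom (cert ρ)) _ ρ x) (eval-protocol s _ (next ρ x) x)

  queries-protocol : ∀ {k} → (∀ ρ → codim (cert ρ) ℕ.≤ k) →
                     ∀ s v ρ x → queries (protocol s v ρ) x ℕ.≤ s ℕ.* k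
  queries-protocol short zero    v ρ x = z≤n
  queries-protocol {k} short (suc s) v ρ x = begin
    queries (protocol (suc s) v ρ) x  ≡⟨ queries-queryAll (dom (cert ρ)) _ ρ x ⟩
    List.length (dom (cert ρ)) ℕ.+ queries (protocol s v′ (next ρ x)) x
      ≤⟨ ℕₚ.+-mono-≤ (subst (ℕ._≤ k) (sym (length-dom (cert ρ))) (short ρ))
                     (queries-protocol short s v′ (next ρ x) x) ⟩
    suc s ℕ.* k ∎
    where
    open ℕₚ.≤-Reasoning
    v′ = addVote (vote ρ) v

  tally-total : ∀ s v ρ x →
                tally s v ρ x true ℕ.+ tally s v ρ x false ≡ s ℕ.+ (v true ℕ.+ v false)
  tally-total zero    v ρ x = refl
  tally-total (suc s) v ρ x = trans (tally-total s _ (next ρ x) x) (added (vote ρ))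
    where
    added : ∀ b → s ℕ.+ (addVote b v true ℕ.+ addVote b v false) ≡ suc s ℕ.+ (v true ℕ.+ v false)
    added true  = ℕₚ.+-suc s _
    added false = trans (cong (s ℕ.+_) (ℕₚ.+-suc (v true) _)) (ℕₚ.+-suc s _)

  module _ (compatible : ∀ ρ → Compatible ρ (cert ρ)) where

    block : Assignment n → Vec Bool n → Subset n
    block ρ x = zipWith _xor_ x (override (cert ρ) x)

    -- Outside its domain the certificate leaves `x` alone, and on the bits known from `ρ` it agrees
    -- with `x` by compatibility; a changed bit is therefore new and about to be read.
    block-fresh : ∀ ρ {x} → Agrees ρ x → ∀ {i} → i ∈ block ρ x →
                  lookup ρ i ≡ nothing × i ∈ₗ dom (cert ρ)
    block-fresh ρ {x} agrees {i} i∈B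
      with lookup (cert ρ) i in eqA
         | lookup-zipWith (λ a b → fromMaybe b a) i (cert ρ) x
    ... | nothing | eq = contradiction (sym eq) (∈-xor⇒≢ i∈B)
    ... | just d  | eq with lookup ρ i in eqρ
    ...   | nothing = refl , ∈-dom (cert ρ) eqA
    ...   | just c  = contradiction
      (trans (agrees i eqρ) (trans (compatible ρ i eqρ eqA) (sym eq))) (∈-xor⇒≢ i∈B)

    -- Freshness is the induction invariant: blocks found in later rounds avoid every bit read so
    -- far.
    FreshBlocks : Assignment n → Vec Bool n → ℕ → Set
    FreshBlocks ρ x k =
      Σ[ (B , _) ∈ SensitiveBlocks f x k ] ∀ j {i} → i ∈ B j → lookup ρ i ≡ nothing

    weaken : ∀ {ρ x k} → FreshBlocks (next ρ x) x k → FreshBlocks ρ x k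
    weaken {ρ} (B , fresh) = B , λ j → proj₁ ∘ reveal-nothing (dom (cert ρ)) ∘ fresh j

    -- The present block lies inside `dom (cert ρ)`, all of which is set in `next ρ x`, whereas the
    -- later blocks use only bits unset there. Hence they are disjoint.
    extend : ∀ {ρ x k} → Agrees ρ x → f x ≢ f (override (cert ρ) x) →
             FreshBlocks (next ρ x) x k → FreshBlocks ρ x (suc k)
    extend {ρ} {x} {k} agrees sensitive₀ ((B , disjoint , sensitive) , fresh) =
      (B′ , disjoint′ , sensitive′) , fresh′
      where
      B′ : Fin (suc k) → Subset n
      B′ = block ρ x Vector.∷ B

      meets : ∀ {i j} → i ∈ block ρ x → i ∈ B j → ⊥
      meets {j = j} i∈B₀ i∈Bⱼ =
        proj₂ (reveal-nothing (dom (cert ρ)) (fresh j i∈Bⱼ)) (proj₂ (block-fresh ρ agrees i∈B₀))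

      disjoint′ : ∀ i j → i ≢ j → Empty (B′ i ∩ B′ j)
      disjoint′ zero    zero    0≢0 _       = 0≢0 refl
      disjoint′ zero    (suc j) _   (_ , m) = let p , q = x∈p∩q⁻ _ _ m in meets p q
      disjoint′ (suc i) zero    _   (_ , m) = let p , q = x∈p∩q⁻ _ _ m in meets q p
      disjoint′ (suc i) (suc j) i≢j         = disjoint i j (i≢j ∘ cong suc)

      sensitive′ : ∀ j → f x ≢ f (flipOn (B′ j) x)
      sensitive′ zero    = subst (λ y → f x ≢ f y) (sym (flipOn-xor x _)) sensitive₀
      sensitive′ (suc j) = sensitive j

      fresh′ : ∀ j {i} → i ∈ B′ j → lookup ρ i ≡ nothing
      fresh′ zero    = proj₁ ∘ block-fresh ρ agrees
      fresh′ (suc j) = proj₁ ∘ reveal-nothing (dom (cert ρ)) ∘ fresh j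

    -- Each vote against `f x` is charged either to a misled round or to a new sensitive block. A
    -- misled vote for `f x` only adds slack.
    wrong-votes : ∀ s v ρ x → Agrees ρ x →
      ∃[ k ] FreshBlocks ρ x k ×
             tally s v ρ x (not (f x)) ℕ.≤ v (not (f x)) ℕ.+ (k ℕ.+ misleds s ρ x)
    wrong-votes zero    v ρ x agrees =
      0 , (((λ ()) , (λ ()) , (λ ())) , (λ ())) , ℕₚ.≤-reflexive (sym (ℕₚ.+-identityʳ _))
    wrong-votes (suc s) v ρ x agrees
      with wrong-votes s (addVote (vote ρ) v) (next ρ x) x (reveal-agrees (dom (cert ρ)) agrees)
    ... | k , blocks , le with vote ρ ≟ not (f x) | f (override (cert ρ) x) ≟ vote ρ
    ...   | no  _  | yes _ = k , weaken blocks , le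
    ...   | no  _  | no  _ = k , weaken blocks ,
      ℕₚ.≤-trans le (ℕₚ.+-monoʳ-≤ (v (not (f x))) (ℕₚ.+-monoʳ-≤ k (ℕₚ.n≤1+n _)))
    -- Here `f` takes the value `not (f x)` at the overridden point, so the changed bits form a
    -- sensitive block.
    ...   | yes eq | yes eq′ =
      suc k , extend agrees (λ fx≡ → not-¬ refl (trans fx≡ (trans eq′ eq))) blocks ,
      ℕₚ.≤-trans le (ℕₚ.≤-reflexive (sym (ℕₚ.+-suc (v (not (f x))) _)))
    ...   | yes eq | no  _ = k , weaken blocks ,
      ℕₚ.≤-trans le (ℕₚ.≤-reflexive
        (trans (sym (ℕₚ.+-suc (v (not (f x))) _))
               (cong (v (not (f x)) ℕ.+_) (sym (ℕₚ.+-suc k _)))))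

    wrong⇒misled : ∀ {bs} → IsBs f bs → ∀ ρ x → Agrees ρ x →
      eval (protocol (4 ℕ.* bs) (λ _ → 0) ρ) x ≢ f x → bs ℕ.≤ misleds (4 ℕ.* bs) ρ x
    wrong⇒misled {bs} isBs ρ x agrees wrong
      with k , (blocks , _) , le ← wrong-votes (4 ℕ.* bs) (λ _ → 0) ρ x agrees =
      -- Of the at least `bs + bs` wrong votes, blocks absorb at most `bs`; the rest are misled.
      ℕₚ.+-cancelˡ-≤ bs _ _ (ℕₚ.≤-trans half
        (ℕₚ.≤-trans le (ℕₚ.+-monoˡ-≤ _ (sensitiveBlocks-≤-bs isBs blocks))))
      where
      w = tally (4 ℕ.* bs) (λ _ → 0) ρ x

      double : 4 ℕ.* bs ≡ (bs ℕ.+ bs) ℕ.+ (bs ℕ.+ bs)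
      double = trans (cong (λ z → bs ℕ.+ (bs ℕ.+ (bs ℕ.+ z))) (ℕₚ.+-identityʳ bs))
                     (sym (ℕₚ.+-assoc bs bs _))

      twice-cancel : ∀ {a b} → a ℕ.+ a ℕ.≤ b ℕ.+ b → a ℕ.≤ b
      twice-cancel le = ℕₚ.≮⇒≥ λ b<a → ℕₚ.<⇒≱ (ℕₚ.+-mono-< b<a b<a) le

      half : bs ℕ.+ bs ℕ.≤ w (not (f x))
      half = twice-cancel (begin
        (bs ℕ.+ bs) ℕ.+ (bs ℕ.+ bs)  ≡⟨ double ⟨
        4 ℕ.* bs                     ≡⟨ ℕₚ.+-identityʳ _ ⟨
        4 ℕ.* bs ℕ.+ 0               ≡⟨ tally-total (4 ℕ.* bs) (λ _ → 0) ρ x ⟨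
        w true ℕ.+ w false           ≤⟨ majority-wrong w (wrong ∘ trans (eval-protocol (4 ℕ.* bs) _ ρ x)) ⟩
        w (not (f x)) ℕ.+ w (not (f x)) ∎)
        where open ℕₚ.≤-Reasoning

-- Arithmetic in an ordered field with undecidable order.

module OrderedFieldProperties {c ℓ₁ ℓ₂} (F : OrderedField c ℓ₁ ℓ₂) where
  open OrderedField F
    renaming (refl to ≈-refl; sym to ≈-sym; trans to ≈-trans; reflexive to ≈-reflexive)
    hiding (zero)
  open CommutativeRing commutativeRing using (ring)
  open RingProperties ring using (-‿distribʳ-*; -1*x≈-x; -‿involutive)
  open IsStrictPartialOrder isStrictPartialOrder using (<-resp-≈)
    renaming (irrefl to <-irrefl; trans to <-trans)

  <-respʳ : ∀ {x y z} → y ≈ z → x < y → x < z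
  <-respʳ = proj₁ <-resp-≈

  <-respˡ : ∀ {x y z} → x ≈ y → x < z → y < z
  <-respˡ = proj₂ <-resp-≈

  <⇒≤ : ∀ {x y} → x < y → x ≤ y
  <⇒≤ x<y y<x = <-irrefl ≈-refl (<-trans x<y y<x)

  ≤-reflexive : ∀ {x y} → x ≈ y → x ≤ y
  ≤-reflexive x≈y = <-irrefl (≈-sym x≈y)

  -- Inherited from cotransitivity of apartness; it stands in for trichotomy, and transitivity of
  -- the negatively defined `≤` rests on it.
  <-cotrans : ∀ {x z} → x < z → ∀ y → x < y ⊎ y < z
  <-cotrans x<z y with #-cotrans (<⇒# x<z) y
  ... | inj₁ x#y with #⇒<⊎> x#y
  ...   | inj₁ x<y = inj₁ x<y
  ...   | inj₂ y<x = inj₂ (<-trans y<x x<z)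
  <-cotrans x<z y | inj₂ y#z with #⇒<⊎> y#z
  ...   | inj₁ y<z = inj₂ y<z
  ...   | inj₂ z<y = inj₁ (<-trans x<z z<y)

  ≤-trans : ∀ {x y z} → x ≤ y → y ≤ z → x ≤ z
  ≤-trans {y = y} x≤y y≤z z<x with <-cotrans z<x y
  ... | inj₁ z<y = y≤z z<y
  ... | inj₂ y<x = x≤y y<x

  <-≤-trans : ∀ {x y z} → x < y → y ≤ z → x < z
  <-≤-trans {z = z} x<y y≤z with <-cotrans x<y z
  ... | inj₁ x<z = x<z
  ... | inj₂ z<y = contradiction z<y y≤z

  ≤-antisym : ∀ {x y} → x ≤ y → y ≤ x → x ≈ y
  ≤-antisym x≤y y≤x = proj₁ (tight _ _) λ x#y → case (#⇒<⊎> x#y)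
    where
    case : _ ⊎ _ → ⊥
    case (inj₁ x<y) = y≤x x<y
    case (inj₂ y<x) = x≤y y<x

  ≤-poset : Poset c ℓ₁ ℓ₂
  ≤-poset = record
    { _≈_ = _≈_ ; _≤_ = _≤_
    ; isPartialOrder = record
      { isPreorder = record
        { isEquivalence = isEquivalence ; reflexive = ≤-reflexive ; trans = ≤-trans }
      ; antisym = ≤-antisym } }

  x+[-x+y] : ∀ x y → - x + (x + y) ≈ y
  x+[-x+y] x y = ≈-trans (≈-sym (+-assoc _ _ _)) (≈-trans (+-congʳ (-‿inverseˡ x)) (+-identityˡ y))

  +-monoʳ-≤ : ∀ x {y z} → y ≤ z → x + y ≤ x + z
  +-monoʳ-≤ x {y} {z} y≤z x+z<x+y =
    y≤z (<-respˡ (x+[-x+y] x z) (<-respʳ (x+[-x+y] x y) (+-monoʳ-< (- x) x+z<x+y)))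

  +-monoˡ-≤ : ∀ x {y z} → y ≤ z → y + x ≤ z + x
  +-monoˡ-≤ x {y} {z} y≤z =
    ≤-trans (≤-reflexive (+-comm y x)) (≤-trans (+-monoʳ-≤ x y≤z) (≤-reflexive (+-comm x z)))

  +-monoˡ-< : ∀ x {y z} → y < z → y + x < z + x
  +-monoˡ-< x {y} {z} y<z = <-respˡ (+-comm x y) (<-respʳ (+-comm x z) (+-monoʳ-< x y<z))

  +-mono-≤ : ∀ {x y u v} → x ≤ y → u ≤ v → x + u ≤ y + v
  +-mono-≤ {y = y} {u = u} x≤y u≤v = ≤-trans (+-monoˡ-≤ u x≤y) (+-monoʳ-≤ y u≤v)

  x<y⇒0<y-x : ∀ {x y} → x < y → 0# < y - x
  x<y⇒0<y-x {x} x<y = <-respˡ (-‿inverseʳ x) (+-monoˡ-< (- x) x<y)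

  0<y-x⇒x<y : ∀ {x y} → 0# < y - x → x < y
  0<y-x⇒x<y {x} {y} 0<y-x = <-respˡ (+-identityˡ x) (<-respʳ cancel (+-monoˡ-< x 0<y-x))
    where
    cancel : y - x + x ≈ y
    cancel = ≈-trans (+-assoc y (- x) x) (≈-trans (+-congˡ (-‿inverseˡ x)) (+-identityʳ y))

  *-monoʳ-< : ∀ {a x y} → 0# < a → x < y → a * x < a * y
  *-monoʳ-< {a} {x} {y} 0<a x<y = 0<y-x⇒x<y (<-respʳ expand (*-pos 0<a (x<y⇒0<y-x x<y)))
    where
    expand : a * (y - x) ≈ a * y - a * x
    expand = ≈-trans (distribˡ a y (- x)) (+-congˡ (≈-sym (-‿distribʳ-* a x)))

  -- The cases `a ≈ 0#` and `0# < a` cannot be separated. Given `a * y < a * x`, a positive `a`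
  -- would force `x ≈ y`, so `a ≈ 0#`; but then both products vanish.
  *-monoʳ-≤ : ∀ {a x y} → 0# ≤ a → x ≤ y → a * x ≤ a * y
  *-monoʳ-≤ {a} {x} {y} 0≤a x≤y ay<ax = <-irrefl (≈-trans (a*≈0 y) (≈-sym (a*≈0 x))) ay<ax
    where
    a≤0 : a ≤ 0#
    a≤0 0<a = <-irrefl (*-congˡ (≈-sym (≤-antisym x≤y y≤x))) ay<ax
      where
      y≤x : y ≤ x
      y≤x x<y = <-irrefl ≈-refl (<-trans ay<ax (*-monoʳ-< 0<a x<y))

    a*≈0 : ∀ z → a * z ≈ 0#
    a*≈0 z = ≈-trans (*-congʳ (≤-antisym a≤0 0≤a)) (zeroˡ z)

  0<1 : 0# < 1#
  0<1 with #⇒<⊎> (HeytingProperties.1#0 heytingCommutativeRing)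
  ... | inj₂ 0<1 = 0<1
  -- If 1 were negative, it would still be the square of the positive element `- 1#`.
  ... | inj₁ 1<0 = <-respʳ [-1]² (*-pos 0<-1 0<-1)
    where
    0<-1 : 0# < - 1#
    0<-1 = <-respʳ (+-identityˡ (- 1#)) (x<y⇒0<y-x 1<0)
    [-1]² : - 1# * - 1# ≈ 1#
    [-1]² = ≈-trans (-1*x≈-x (- 1#)) (-‿involutive 1#)

  ·-monoʳ-≤ : ∀ k {x y} → x ≤ y → k · x ≤ k · y
  ·-monoʳ-≤ zero    x≤y = ≤-reflexive ≈-refl
  ·-monoʳ-≤ (suc k) x≤y = +-mono-≤ x≤y (·-monoʳ-≤ k x≤y)

  ·-cancelˡ-≤ : ∀ k .{{_ : ℕ.NonZero k}} {x y} → k · x ≤ k · y → x ≤ y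
  ·-cancelˡ-≤ (suc k) {x} {y} kx≤ky y<x =
    kx≤ky (<-≤-trans (+-monoˡ-< (k · y) y<x) (+-monoʳ-≤ x (·-monoʳ-≤ k (<⇒≤ y<x))))

  ·-zeroʳ : ∀ k → k · 0# ≈ 0#
  ·-zeroʳ zero    = ≈-refl
  ·-zeroʳ (suc k) = ≈-trans (+-identityˡ _) (·-zeroʳ k)

  0≤·1 : ∀ k → 0# ≤ k · 1#
  0≤·1 zero    = ≤-reflexive ≈-refl
  0≤·1 (suc k) = ≤-trans (≤-reflexive (≈-sym (+-identityˡ 0#))) (+-mono-≤ (<⇒≤ 0<1) (0≤·1 k))

  ·-monoˡ-≤ : ∀ {j k} → j ℕ.≤ k → j · 1# ≤ k · 1#
  ·-monoˡ-≤ {k = k} z≤n       = 0≤·1 k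
  ·-monoˡ-≤ (s≤s j≤k) = +-monoʳ-≤ 1# (·-monoˡ-≤ j≤k)

  recip-inverse : ∀ {x} (0<x : 0# < x) → x * recip 0<x ≈ 1#
  recip-inverse {x} 0<x = ≈-trans (*-congʳ (≈-sym (HeytingProperties.x-0≈x heytingCommutativeRing x)))
    (proj₂ (proj₂ (#⇒invertible (#-sym (<⇒# 0<x)))))

-- Expectation under a product measure.

module Expectation {c ℓ₁ ℓ₂} (F : OrderedField c ℓ₁ ℓ₂) where
  open OrderedField F
    renaming (refl to ≈-refl; sym to ≈-sym; trans to ≈-trans; reflexive to ≈-reflexive)
    hiding (zero)
  open OrderedFieldProperties F
  open Queries F
  open CommutativeRing commutativeRing using (semiring; commutativeSemiring)
  open Multiples semiring using (×-homo-+; ×-assocˡ; ×-congˡ)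
  open RingSolver commutativeSemiring using (solve; _:=_; _:+_; _:*_; con)

  Marginals : ℕ → Set c
  Marginals n = Fin n → Bool → Carrier

  Stochastic : Marginals n → Set _
  Stochastic m = (∀ i b → 0# ≤ m i b) × (∀ i → m i false + m i true ≈ 1#)

  tail-stochastic : {m : Marginals (suc n)} → Stochastic m → Stochastic (m ∘ suc)
  tail-stochastic (nonneg , total) = nonneg ∘ suc , total ∘ suc

  𝟙 : Bool → Carrier
  𝟙 b = if b then 1# else 0#

  -- Recursion on the coordinates makes the product structure available to induction; `∑-∏≈𝔼`
  -- identifies it with the sum weighted by masses.
  𝔼 : Marginals n → (Vec Bool n → Carrier) → Carrier
  𝔼 {n = zero}  m g = g []
  𝔼 {n = suc n} m g =
    m zero false * 𝔼 (m ∘ suc) (g ∘ (false ∷_)) + m zero true * 𝔼 (m ∘ suc) (g ∘ (true ∷_))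

  𝔼-cong : ∀ (m : Marginals n) {g h} → (∀ x → g x ≈ h x) → 𝔼 m g ≈ 𝔼 m h
  𝔼-cong {n = zero}  m g≈h = g≈h []
  𝔼-cong {n = suc n} m g≈h =
    +-cong (*-congˡ (𝔼-cong (m ∘ suc) (g≈h ∘ (false ∷_))))
           (*-congˡ (𝔼-cong (m ∘ suc) (g≈h ∘ (true ∷_))))

  𝔼-congˡ : ∀ {m m′ : Marginals n} → (∀ i b → m i b ≈ m′ i b) → ∀ g → 𝔼 m g ≈ 𝔼 m′ g
  𝔼-congˡ {n = zero}  m≈m′ g = ≈-refl
  𝔼-congˡ {n = suc n} m≈m′ g =
    +-cong (*-cong (m≈m′ zero false) (𝔼-congˡ (m≈m′ ∘ suc) (g ∘ (false ∷_))))
           (*-cong (m≈m′ zero true) (𝔼-congˡ (m≈m′ ∘ suc) (g ∘ (true ∷_))))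

  𝔼-mono : ∀ {m : Marginals n} → Stochastic m → ∀ {g h} → (∀ x → g x ≤ h x) → 𝔼 m g ≤ 𝔼 m h
  𝔼-mono {n = zero}  m-stoch g≤h = g≤h []
  𝔼-mono {n = suc n} m-stoch g≤h =
    +-mono-≤ (*-monoʳ-≤ (proj₁ m-stoch zero false)
               (𝔼-mono (tail-stochastic m-stoch) (g≤h ∘ (false ∷_))))
             (*-monoʳ-≤ (proj₁ m-stoch zero true)
               (𝔼-mono (tail-stochastic m-stoch) (g≤h ∘ (true ∷_))))

  𝔼-+ : ∀ (m : Marginals n) g h → 𝔼 m (λ x → g x + h x) ≈ 𝔼 m g + 𝔼 m h
  𝔼-+ {n = zero}  m g h = ≈-refl
  𝔼-+ {n = suc n} m g h = ≈-trans
    (+-cong (*-congˡ (𝔼-+ (m ∘ suc) (g ∘ (false ∷_)) (h ∘ (false ∷_))))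
            (*-congˡ (𝔼-+ (m ∘ suc) (g ∘ (true ∷_)) (h ∘ (true ∷_)))))
    (solve 6 (λ p q a b a′ b′ →
       p :* (a :+ b) :+ q :* (a′ :+ b′) := (p :* a :+ q :* a′) :+ (p :* b :+ q :* b′))
       ≈-refl _ _ _ _ _ _)

  average : ∀ {p q} → p + q ≈ 1# → ∀ a → p * a + q * a ≈ a
  average p+q≈1 a = ≈-trans (≈-sym (distribʳ a _ _)) (≈-trans (*-congʳ p+q≈1) (*-identityˡ a))

  𝔼-const : ∀ {m : Marginals n} → Stochastic m → ∀ a → 𝔼 m (λ _ → a) ≈ a
  𝔼-const {n = zero}  m-stoch a = ≈-refl
  𝔼-const {n = suc n} m-stoch a = ≈-trans
    (+-cong (*-congˡ (𝔼-const (tail-stochastic m-stoch) a))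
            (*-congˡ (𝔼-const (tail-stochastic m-stoch) a)))
    (average (proj₂ m-stoch zero) a)

  𝔼-· : ∀ {m : Marginals n} → Stochastic m → ∀ k g → 𝔼 m (λ x → k · g x) ≈ k · 𝔼 m g
  𝔼-· m-stoch zero    g = 𝔼-const m-stoch 0#
  𝔼-· m-stoch (suc k) g = ≈-trans (𝔼-+ _ g (λ x → k · g x)) (+-congˡ (𝔼-· m-stoch k g))

  𝔼-complement : ∀ {m : Marginals n} → Stochastic m → ∀ (e : BoolFun n) →
                 𝔼 m (𝟙 ∘ e) + 𝔼 m (𝟙 ∘ not ∘ e) ≈ 1#
  𝔼-complement {m = m} m-stoch e = ≈-trans (≈-sym (𝔼-+ m (𝟙 ∘ e) (𝟙 ∘ not ∘ e)))
    (≈-trans (𝔼-cong m (𝟙-complement ∘ e)) (𝔼-const m-stoch 1#))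
    where
    𝟙-complement : ∀ b → 𝟙 b + 𝟙 (not b) ≈ 1#
    𝟙-complement true  = +-identityʳ 1#
    𝟙-complement false = +-identityˡ 1#

  ∑-cong : ∀ {g h : Vec Bool n → Carrier} → (∀ x → g x ≈ h x) → ∑ g ≈ ∑ h
  ∑-cong {n = zero}  g≈h = g≈h []
  ∑-cong {n = suc n} g≈h = +-cong (∑-cong (g≈h ∘ (false ∷_))) (∑-cong (g≈h ∘ (true ∷_)))

  ∑-*ˡ : ∀ a (g : Vec Bool n → Carrier) → ∑ (λ x → a * g x) ≈ a * ∑ g
  ∑-*ˡ {n = zero}  a g = ≈-refl
  ∑-*ˡ {n = suc n} a g = ≈-trans
    (+-cong (∑-*ˡ a (g ∘ (false ∷_))) (∑-*ˡ a (g ∘ (true ∷_)))) (≈-sym (distribˡ a _ _))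

  ∏-mass : Marginals n → Vec Bool n → Carrier
  ∏-mass m x = ∏ (λ i → m i (lookup x i))

  ∑-∏≈𝔼 : ∀ (m : Marginals n) g → ∑ (λ x → ∏-mass m x * g x) ≈ 𝔼 m g
  ∑-∏≈𝔼 {n = zero}  m g = *-identityˡ (g [])
  ∑-∏≈𝔼 {n = suc n} m g = +-cong (half false) (half true)
    where
    half : ∀ b → ∑ (λ x → ∏-mass m (b ∷ x) * g (b ∷ x)) ≈ m zero b * 𝔼 (m ∘ suc) (g ∘ (b ∷_))
    half b = ≈-trans (∑-cong (λ x → *-assoc (m zero b) (∏-mass (m ∘ suc) x) (g (b ∷ x))))
      (≈-trans (∑-*ˡ (m zero b) (λ x → ∏-mass (m ∘ suc) x * g (b ∷ x)))
        (*-congˡ (∑-∏≈𝔼 (m ∘ suc) (g ∘ (b ∷_)))))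

  Pr≈𝔼 : ∀ (μ : Distribution n) (m : Marginals n) → (∀ x → mass μ x ≈ ∏-mass m x) →
         ∀ e → Pr μ e ≈ 𝔼 m (𝟙 ∘ e)
  Pr≈𝔼 μ m μ≈∏ e = ≈-trans (∑-cong (λ x → pointwise (e x) x)) (∑-∏≈𝔼 m (𝟙 ∘ e))
    where
    pointwise : ∀ b x → (if b then mass μ x else 0#) ≈ ∏-mass m x * 𝟙 b
    pointwise true  x = ≈-trans (μ≈∏ x) (≈-sym (*-identityʳ _))
    pointwise false x = ≈-sym (zeroʳ _)

  ∏-mass-nonneg : ∀ {m : Marginals n} → (∀ i b → 0# ≤ m i b) → ∀ x → 0# ≤ ∏-mass m x
  ∏-mass-nonneg nonneg []      = <⇒≤ 0<1
  ∏-mass-nonneg nonneg (b ∷ x) = ≤-trans (≤-reflexive (≈-sym (zeroʳ _)))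
    (*-monoʳ-≤ (nonneg zero b) (∏-mass-nonneg (nonneg ∘ suc) x))

  productDistribution : ∀ {m : Marginals n} → Stochastic m → Distribution n
  productDistribution {m = m} m-stoch = record
    { mass        = ∏-mass m
    ; mass-nonneg = ∏-mass-nonneg (proj₁ m-stoch)
    ; mass-total  = ≈-trans (∑-cong (λ x → ≈-sym (*-identityʳ (∏-mass m x))))
                      (≈-trans (∑-∏≈𝔼 m (λ _ → 1#)) (𝔼-const m-stoch 1#))
    }

  productDistribution-isProduct : ∀ {m : Marginals n} (m-stoch : Stochastic m) →
                                  IsProduct (productDistribution m-stoch)
  productDistribution-isProduct {m = m} m-stoch@(nonneg , total) =
    m , (λ i b → nonneg i b , ≤1 i b) , total , λ _ → ≈-refl
    where
    ≤1 : ∀ i b → m i b ≤ 1#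
    ≤1 i false = ≤-trans (≤-reflexive (≈-sym (+-identityʳ _)))
      (≤-trans (+-monoʳ-≤ _ (nonneg i true)) (≤-reflexive (total i)))
    ≤1 i true  = ≤-trans (≤-reflexive (≈-sym (+-identityˡ _)))
      (≤-trans (+-monoˡ-≤ _ (nonneg i false)) (≤-reflexive (total i)))

  -- Conditioning on the bits read.

  pin : Maybe Bool → (Bool → Carrier) → Bool → Carrier
  pin nothing  p b = p b
  pin (just a) p b = 𝟙 (does (b ≟ a))

  -- Fixed coordinates become point masses. The result is again a product measure, and it makes
  -- sense even when `ρ` has probability zero.
  condition : Assignment n → Marginals n → Marginals n
  condition ρ m i = pin (lookup ρ i) (m i)

  condition-stochastic : ∀ (ρ : Assignment n) {m} → Stochastic m → Stochastic (condition ρ m)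
  condition-stochastic ρ {m} (nonneg , total) = nonneg′ , total′
    where
    𝟙-nonneg : ∀ b → 0# ≤ 𝟙 b
    𝟙-nonneg true  = <⇒≤ 0<1
    𝟙-nonneg false = ≤-reflexive ≈-refl
    nonneg′ : ∀ i b → 0# ≤ condition ρ m i b
    nonneg′ i b with lookup ρ i
    ... | nothing = nonneg i b
    ... | just a  = 𝟙-nonneg (does (b ≟ a))
    total′ : ∀ i → condition ρ m i false + condition ρ m i true ≈ 1#
    total′ i with lookup ρ i
    ... | nothing    = total i
    ... | just false = +-identityʳ 1#
    ... | just true  = +-identityˡ 1#

  -- The law of total probability for bit `i`. If `ρ` fixes that bit already, one branch has weight
  -- 0.
  𝔼-query : ∀ (ρ : Assignment n) m i g →
    𝔼 (condition ρ m) g ≈ condition ρ m i false * 𝔼 (condition (ρ [ i ]≔ just false) m) g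
                        + condition ρ m i true * 𝔼 (condition (ρ [ i ]≔ just true) m) g
  𝔼-query (a ∷ ρ) m zero    g =
    solve 4 (λ p q s t → p :* s :+ q :* t :=
                         p :* (con 1 :* s :+ con 0 :* t) :+ q :* (con 0 :* s :+ con 1 :* t))
      ≈-refl (pin a (m zero) false) (pin a (m zero) true) _ _
  𝔼-query (a ∷ ρ) m (suc i) g = ≈-trans
    (+-cong (*-congˡ (𝔼-query ρ (m ∘ suc) i (g ∘ (false ∷_))))
            (*-congˡ (𝔼-query ρ (m ∘ suc) i (g ∘ (true ∷_)))))
    (solve 8 (λ p q s t a b a′ b′ →
       p :* (s :* a :+ t :* b) :+ q :* (s :* a′ :+ t :* b′) :=
       s :* (p :* a :+ q :* a′) :+ t :* (p :* b :+ q :* b′))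
       ≈-refl (pin a (m zero) false) (pin a (m zero) true) _ _ _ _ _ _)

  𝔼-pinned-cong : ∀ (ρ : Assignment n) m i b {g h} → (∀ x → lookup x i ≡ b → g x ≈ h x) →
    𝔼 (condition (ρ [ i ]≔ just b) m) g ≈ 𝔼 (condition (ρ [ i ]≔ just b) m) h
  𝔼-pinned-cong (a ∷ ρ) m zero false g≈h =
    +-cong (*-congˡ (𝔼-cong (condition ρ (m ∘ suc)) (λ x → g≈h (false ∷ x) refl)))
           (≈-trans (zeroˡ _) (≈-sym (zeroˡ _)))
  𝔼-pinned-cong (a ∷ ρ) m zero true g≈h =
    +-cong (≈-trans (zeroˡ _) (≈-sym (zeroˡ _)))
           (*-congˡ (𝔼-cong (condition ρ (m ∘ suc)) (λ x → g≈h (true ∷ x) refl)))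
  𝔼-pinned-cong (a ∷ ρ) m (suc i) b g≈h =
    +-cong (*-congˡ (𝔼-pinned-cong ρ (m ∘ suc) i b (g≈h ∘ (false ∷_))))
           (*-congˡ (𝔼-pinned-cong ρ (m ∘ suc) i b (g≈h ∘ (true ∷_))))

  -- The tower property: a bound valid for every conditional measure survives reading more bits,
  -- since the mean is a weighted average over the outcomes.
  𝔼-reveal-≤ : ∀ {m : Marginals n} → Stochastic m → ∀ {G : Assignment n → Vec Bool n → Carrier} {a} →
    (∀ ρ → 𝔼 (condition ρ m) (G ρ) ≤ a) →
    ∀ is ρ → 𝔼 (condition ρ m) (λ x → G (reveal is x ρ) x) ≤ a
  𝔼-reveal-≤ m-stoch bound []       ρ = bound ρ
  𝔼-reveal-≤ {m = m} m-stoch {G} {a} bound (i ∷ is) ρ = begin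
    𝔼 (condition ρ m) G′
      ≈⟨ 𝔼-query ρ m i G′ ⟩
    condition ρ m i false * 𝔼 (ρ′ false) G′ + condition ρ m i true * 𝔼 (ρ′ true) G′
      ≤⟨ +-mono-≤ (branch false) (branch true) ⟩
    condition ρ m i false * a + condition ρ m i true * a
      ≈⟨ average (proj₂ ρ-stoch i) a ⟩
    a ∎
    where
    open ≤-Reasoning ≤-poset
    ρ-stoch = condition-stochastic ρ m-stoch
    ρ′ : Bool → Marginals _
    ρ′ b = condition (ρ [ i ]≔ just b) m
    G′ : Vec Bool _ → Carrier
    G′ x = G (reveal (i ∷ is) x ρ) x
    branch : ∀ b → condition ρ m i b * 𝔼 (ρ′ b) G′ ≤ condition ρ m i b * a
    branch b = *-monoʳ-≤ (proj₁ ρ-stoch i b) (begin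
      𝔼 (ρ′ b) G′
        -- Under `ρ′ b` all mass sits on inputs with bit `i` equal to `b`, so the value read may be
        -- replaced by `b`.
        ≈⟨ 𝔼-pinned-cong ρ m i b (λ x xᵢ≡b → ≈-reflexive
             (cong (λ b → G (reveal is x (ρ [ i ]≔ just b)) x) xᵢ≡b)) ⟩
      𝔼 (ρ′ b) (λ x → G (reveal is x (ρ [ i ]≔ just b)) x)
        ≤⟨ 𝔼-reveal-≤ m-stoch bound is (ρ [ i ]≔ just b) ⟩
      a ∎)

  -- Subcubes, positive mass and conditional probability.

  -- The probability of the subcube as a product over its fixed coordinates; see `Pr-subcube`.
  weight : Assignment n → Marginals n → Carrier
  weight []             m = 1#
  weight (nothing ∷ A) m = weight A (m ∘ suc)
  weight (just b  ∷ A) m = m zero b * weight A (m ∘ suc)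

  -- Under a product measure, conditioning on the subcube A is the same as
  -- overriding the input by A.
  𝔼-subcube : ∀ (A : Assignment n) {m} → Stochastic m → ∀ g →
    𝔼 m (λ x → if subcube A x then g x else 0#) ≈ weight A m * 𝔼 m (g ∘ override A)
  𝔼-subcube []             m-stoch g = ≈-sym (*-identityˡ (g []))
  𝔼-subcube (nothing ∷ A) m-stoch g = ≈-trans
    (+-cong (*-congˡ (𝔼-subcube A (tail-stochastic m-stoch) (g ∘ (false ∷_))))
            (*-congˡ (𝔼-subcube A (tail-stochastic m-stoch) (g ∘ (true ∷_)))))
    (solve 5 (λ p q w a b → p :* (w :* a) :+ q :* (w :* b) := w :* (p :* a :+ q :* b))
       ≈-refl _ _ _ _ _)
  𝔼-subcube (just false ∷ A) {m} m-stoch g = begin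
    m zero false * _ + m zero true * 𝔼 (m ∘ suc) (λ _ → 0#)
      ≈⟨ +-cong (*-congˡ (𝔼-subcube A m′-stoch (g ∘ (false ∷_)))) (*-congˡ (𝔼-const m′-stoch 0#)) ⟩
    m zero false * (w * e) + m zero true * 0#
      ≈⟨ solve 4 (λ p q w e → p :* (w :* e) :+ q :* con 0 := (p :* w) :* e) ≈-refl _ _ w e ⟩
    (m zero false * w) * e
      -- The overridden input still draws a first bit and then ignores it, hence the trivial average
      -- of `e` with itself.
      ≈⟨ *-congˡ (average (proj₂ m-stoch zero) e) ⟨
    (m zero false * w) * (m zero false * e + m zero true * e) ∎
    where
    open ≈-Reasoning setoid
    m′-stoch = tail-stochastic m-stoch
    w = weight A (m ∘ suc)
    e = 𝔼 (m ∘ suc) (g ∘ (false ∷_) ∘ override A)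
  𝔼-subcube (just true ∷ A) {m} m-stoch g = begin
    m zero false * 𝔼 (m ∘ suc) (λ _ → 0#) + m zero true * _
      ≈⟨ +-cong (*-congˡ (𝔼-const m′-stoch 0#)) (*-congˡ (𝔼-subcube A m′-stoch (g ∘ (true ∷_)))) ⟩
    m zero false * 0# + m zero true * (w * e)
      ≈⟨ solve 4 (λ p q w e → p :* con 0 :+ q :* (w :* e) := (q :* w) :* e) ≈-refl _ _ w e ⟩
    (m zero true * w) * e
      ≈⟨ *-congˡ (average (proj₂ m-stoch zero) e) ⟨
    (m zero true * w) * (m zero false * e + m zero true * e) ∎
    where
    open ≈-Reasoning setoid
    m′-stoch = tail-stochastic m-stoch
    w = weight A (m ∘ suc)
    e = 𝔼 (m ∘ suc) (g ∘ (true ∷_) ∘ override A)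

  weight-incompatible : ∀ (ρ A : Assignment n) m i {a b} →
    lookup ρ i ≡ just a → lookup A i ≡ just b → a ≢ b → weight A (condition ρ m) ≈ 0#
  weight-incompatible (just a ∷ ρ) (just b ∷ A) m zero refl refl a≢b with b ≟ a
  ... | yes refl = contradiction refl a≢b
  ... | no  _    = zeroˡ _
  weight-incompatible (_ ∷ ρ) (nothing ∷ A) m (suc i) eqρ eqA a≢b =
    weight-incompatible ρ A (m ∘ suc) i eqρ eqA a≢b
  weight-incompatible (_ ∷ ρ) (just _ ∷ A) m (suc i) eqρ eqA a≢b =
    ≈-trans (*-congˡ (weight-incompatible ρ A (m ∘ suc) i eqρ eqA a≢b)) (zeroʳ _)

  -- Contradicting a pinned bit costs a factor 0, so the positivity clause of a certificate makes it
  -- consistent with the bits already read.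
  0<weight⇒compatible : ∀ (ρ A : Assignment n) m → 0# < weight A (condition ρ m) → Compatible ρ A
  0<weight⇒compatible ρ A m 0<w i {a} {b} eqρ eqA = decidable-stable (a ≟ b) λ a≢b →
    ≤-reflexive (weight-incompatible ρ A m i eqρ eqA a≢b) 0<w

  -- In each coordinate the two marginals sum to 1, so they are not both at most 0; which one is
  -- positive cannot be decided.
  ¬¬-support : ∀ {m : Marginals n} → Stochastic m → ¬ ¬ (∃[ x ] 0# < weight (map just x) m)
  ¬¬-support {n = zero}  m-stoch none = none ([] , 0<1)
  ¬¬-support {n = suc n} {m} m-stoch none = ¬¬-support (tail-stochastic m-stoch) λ (x , 0<w) →
    let ≤0 : ∀ b → m zero b ≤ 0#
        ≤0 b 0<p = none (b ∷ x , *-pos 0<p 0<w)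
    in ≤-trans (≤-reflexive (≈-sym (proj₂ m-stoch zero)))
         (≤-trans (+-mono-≤ (≤0 false) (≤0 true)) (≤-reflexive (+-identityˡ 0#))) 0<1

  module _ {m : Marginals n} (m-stoch : Stochastic m) where

    Pr-subcube : ∀ A → Pr (productDistribution m-stoch) (subcube A) ≈ weight A m
    Pr-subcube A = ≈-trans (Pr≈𝔼 (productDistribution m-stoch) m (λ _ → ≈-refl) (subcube A))
      (≈-trans (𝔼-subcube A m-stoch (λ _ → 1#))
        (≈-trans (*-congˡ (𝔼-const m-stoch 1#)) (*-identityʳ _)))

    -- By `𝔼-subcube` the joint probability has the factor `Pr μ (subcube A)`, which the reciprocal
    -- cancels.
    condPr-subcube : ∀ A e 0<p → condPr (productDistribution m-stoch) e (subcube A) 0<p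
                               ≈ 𝔼 m (𝟙 ∘ e ∘ override A)
    condPr-subcube A e 0<p = begin
      Pr μ (λ x → e x ∧ subcube A x) * recip 0<p
        ≈⟨ *-congʳ (≈-trans (Pr≈𝔼 μ m (λ _ → ≈-refl) (λ x → e x ∧ subcube A x))
             (𝔼-cong m (λ x → 𝟙-∧ (e x) (subcube A x)))) ⟩
      𝔼 m (λ x → if subcube A x then 𝟙 (e x) else 0#) * recip 0<p
        ≈⟨ *-congʳ (≈-trans (𝔼-subcube A m-stoch (𝟙 ∘ e)) (*-congʳ (≈-sym (Pr-subcube A)))) ⟩
      (Pr μ (subcube A) * 𝔼 m (𝟙 ∘ e ∘ override A)) * recip 0<p
        ≈⟨ solve 3 (λ p q r → (p :* q) :* r := (p :* r) :* q) ≈-refl _ _ _ ⟩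
      (Pr μ (subcube A) * recip 0<p) * 𝔼 m (𝟙 ∘ e ∘ override A)
        ≈⟨ ≈-trans (*-congʳ (recip-inverse 0<p)) (*-identityˡ _) ⟩
      𝔼 m (𝟙 ∘ e ∘ override A) ∎
      where
      open ≈-Reasoning setoid
      μ = productDistribution m-stoch
      𝟙-∧ : ∀ a b → 𝟙 (a ∧ b) ≈ (if b then 𝟙 a else 0#)
      𝟙-∧ true  true  = ≈-refl
      𝟙-∧ true  false = ≈-refl
      𝟙-∧ false true  = ≈-refl
      𝟙-∧ false false = ≈-refl

  -- Short certificates for product measures.

  disagree : Bool → Bool → Bool
  disagree a b = not (does (a ≟ b))

  disagree-refl : ∀ b → disagree b b ≡ false
  disagree-refl true  = refl
  disagree-refl false = refl

  FewErrors : Marginals n → Carrier → BoolFun n → ℕ → Assignment n → Bool → Set ℓ₂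
  FewErrors m ε f k A b =
    codim A ℕ.≤ k × 0# < weight A m × 𝔼 m (λ x → 𝟙 (disagree (f (override A x)) b)) ≤ ε

  override-full : ∀ (x y : Vec Bool n) → override (map just x) y ≡ x
  override-full []       []      = refl
  override-full (a ∷ x) (_ ∷ y) = cong (a ∷_) (override-full x y)

  -- The measure is a product, so the corruption bound applies once both minima in its definition
  -- are known to exist.
  ¬¬-certificate : ∀ {m : Marginals n} → Stochastic m → ∀ {ε} f {k} → 0# ≤ ε → IsCorr× ε f k →
                   ¬ ¬ (∃[ A ] ∃[ b ] FewErrors m ε f k A b)
  ¬¬-certificate {m = m} m-stoch {ε} f {k} 0≤ε (_ , max) none =
    ¬¬-support m-stoch λ (x , 0<w) →
    -- A fully specified point of positive mass is an error-free certificate, so some certificate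
    -- exists.
    ¬¬-min (λ j → ∃[ A ] IsCertificate (f x) μ ε f A × codim A ≡ j) (full x 0<w) λ (j , isCorr) →
    -- The other bit may have no certificate at all; this minimum ranges over the bits with a finite
    -- value.
    ¬¬-min (λ j → ∃[ b ] IsCorr b μ ε f j) (f x , isCorr) λ {
      (i , isMinCorr@((b , (A , (0<p , err≤ε) , codim≡i) , _) , _)) →
    none (A , b
      , subst (ℕ._≤ k) (sym codim≡i)
          (max i (μ , productDistribution-isProduct m-stoch , isMinCorr))
      , <-respʳ (Pr-subcube m-stoch A) 0<p
      , ≤-trans (≤-reflexive (≈-sym (condPr-subcube m-stoch A (λ y → disagree (f y) b) 0<p))) err≤ε) }
    where
    μ = productDistribution m-stoch
    full : ∀ x → 0# < weight (map just x) m →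
           ∃[ A ] IsCertificate (f x) μ ε f A × codim A ≡ codim (map just x)
    full x 0<w = map just x , (0<p , ≤-trans (≤-reflexive err≈0) 0≤ε) , refl
      where
      0<p = <-respʳ (≈-sym (Pr-subcube m-stoch (map just x))) 0<w
      err≈0 = ≈-trans (condPr-subcube m-stoch (map just x) (λ y → disagree (f y) (f x)) 0<p)
        (≈-trans (𝔼-cong m (λ y → ≈-reflexive (cong 𝟙 (trans
            (cong (λ z → disagree (f z) (f x)) (override-full x y)) (disagree-refl (f x))))))
          (𝔼-const m-stoch 0#))

  -- From a tree with small error to distributional complexity.

  computes-intro : ∀ (μ : Distribution n) m → Stochastic m → (∀ x → mass μ x ≈ ∏-mass m x) →
    ∀ {δ} (f : BoolFun n) t → 𝔼 m (λ x → 𝟙 (disagree (eval t x) (f x))) ≤ δ → Computes μ δ f t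
  computes-intro μ m m-stoch μ≈∏ {δ} f t err≤δ = begin
    1# - δ
      ≈⟨ +-congʳ (𝔼-complement m-stoch correct) ⟨
    (𝔼 m (𝟙 ∘ correct) + 𝔼 m (𝟙 ∘ not ∘ correct)) - δ
      ≤⟨ +-monoˡ-≤ (- δ) (+-monoʳ-≤ _ err≤δ) ⟩
    (𝔼 m (𝟙 ∘ correct) + δ) - δ
      ≈⟨ ≈-trans (+-assoc _ δ (- δ)) (≈-trans (+-congˡ (-‿inverseʳ δ)) (+-identityʳ _)) ⟩
    𝔼 m (𝟙 ∘ correct)
      ≈⟨ Pr≈𝔼 μ m μ≈∏ correct ⟨
    Pr μ correct ∎
    where
    open ≤-Reasoning ≤-poset
    correct : BoolFun _
    correct x = does (eval t x ≟ f x)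

  -- `IsD` compares exact worst-case costs, so the exact cost of `t` is produced first, up to double
  -- negation.
  cheap-tree⇒D≤ : ∀ (μ : Distribution n) δ f {d} → IsD μ δ f d →
    ∀ {k} t → Computes μ δ f t → (∀ x → queries t x ℕ.≤ k) → d ℕ.≤ k
  cheap-tree⇒D≤ μ δ f {d} (_ , least) {k} t computes cheap = decidable-stable (d ℕ.≤? k) λ d≰k →
    ¬¬-max (λ q → ∃[ x ] queries t x ≡ q) (λ { _ (x , refl) → cheap x })
      (replicate _ false , refl) λ { (q , isCost@((x , refl) , _)) →
    d≰k (ℕₚ.≤-trans (least q (t , computes , isCost)) (cheap x)) }

  -- Error of the protocol.

  module _ {m : Marginals n} (m-stoch : Stochastic m) {ε} (f : BoolFun n) {k}
           (certificate : ∀ ρ → ∃[ A ] ∃[ b ] FewErrors (condition ρ m) ε f k A b) where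

    cert : Assignment n → Assignment n
    cert ρ = proj₁ (certificate ρ)

    vote : Assignment n → Bool
    vote ρ = proj₁ (proj₂ (certificate ρ))

    open Protocol f cert vote

    compatible : ∀ ρ → Compatible ρ (cert ρ)
    compatible ρ = 0<weight⇒compatible ρ (cert ρ) m (proj₁ (proj₂ (proj₂ (proj₂ (certificate ρ)))))

    𝔼-misled : ∀ ρ → 𝔼 (condition ρ m) (λ x → misled ρ x · 1#) ≤ ε
    𝔼-misled ρ = ≤-trans
      (≤-reflexive (𝔼-cong (condition ρ m) λ x → 𝟙-not (does (f (override (cert ρ) x) ≟ vote ρ))))
      (proj₂ (proj₂ (proj₂ (proj₂ (certificate ρ)))))
      where
      𝟙-not : ∀ b → (if b then 0 else 1) · 1# ≈ 𝟙 (not b)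
      𝟙-not true  = ≈-refl
      𝟙-not false = +-identityʳ 1#

    -- Linearity of expectation; no independence between rounds enters, since the bound for the
    -- remaining rounds holds given any `ρ`.
    𝔼-misleds : ∀ s ρ → 𝔼 (condition ρ m) (λ x → misleds s ρ x · 1#) ≤ s · ε
    𝔼-misleds zero    ρ = ≤-reflexive (𝔼-const (condition-stochastic ρ m-stoch) 0#)
    𝔼-misleds (suc s) ρ = ≤-trans
      (≤-reflexive (≈-trans
        (𝔼-cong (condition ρ m) (λ x → ×-homo-+ 1# (misled ρ x) (misleds s (next ρ x) x)))
        (𝔼-+ (condition ρ m) _ _)))
      (+-mono-≤ (𝔼-misled ρ)
        (𝔼-reveal-≤ m-stoch {G = λ ρ x → misleds s ρ x · 1#} (𝔼-misleds s) (dom (cert ρ)) ρ))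

    -- Markov's inequality multiplied out by `bs`, which is cancelled at the end.
    protocol-error : ∀ {bs} .{{_ : ℕ.NonZero bs}} → IsBs f bs →
      𝔼 m (λ x → 𝟙 (disagree (eval (protocol (4 ℕ.* bs) (λ _ → 0) (replicate n nothing)) x) (f x)))
        ≤ 4 · ε
    protocol-error {bs} isBs = ·-cancelˡ-≤ bs (begin
      bs · 𝔼 m (λ x → 𝟙 (wrong x))
        ≈⟨ 𝔼-· m-stoch bs (𝟙 ∘ wrong) ⟨
      𝔼 m (λ x → bs · 𝟙 (wrong x))
        ≤⟨ 𝔼-mono m-stoch pointwise ⟩
      𝔼 m (λ x → misleds (4 ℕ.* bs) ∅ x · 1#)
        -- The empty assignment pins nothing.
        ≈⟨ 𝔼-congˡ (λ i b → ≈-reflexive (cong (λ a → pin a (m i) b) (lookup-replicate i nothing))) _ ⟨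
      𝔼 (condition ∅ m) (λ x → misleds (4 ℕ.* bs) ∅ x · 1#)
        ≤⟨ 𝔼-misleds (4 ℕ.* bs) ∅ ⟩
      (4 ℕ.* bs) · ε
        ≈⟨ ×-congˡ (ℕₚ.*-comm 4 bs) ⟩
      (bs ℕ.* 4) · ε
        ≈⟨ ×-assocˡ ε bs 4 ⟨
      bs · 4 · ε ∎)
      where
      open ≤-Reasoning ≤-poset
      ∅ : Assignment n
      ∅ = replicate n nothing
      t = protocol (4 ℕ.* bs) (λ _ → 0) ∅
      wrong : BoolFun n
      wrong x = disagree (eval t x) (f x)
      agrees : ∀ x → Agrees ∅ x
      agrees x i eq = contradiction (trans (sym (lookup-replicate i nothing)) eq) λ ()
      pointwise : ∀ x → bs · 𝟙 (wrong x) ≤ misleds (4 ℕ.* bs) ∅ x · 1#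
      pointwise x with eval t x ≟ f x
      ... | yes _ = ≤-trans (≤-reflexive (·-zeroʳ bs)) (0≤·1 (misleds (4 ℕ.* bs) ∅ x))
      ... | no  ≢ = ·-monoˡ-≤ (wrong⇒misled compatible isBs ∅ x (agrees x) ≢)

  -- Existence of the tree and the final bound.

  module _ {f : BoolFun n} {ε} (0≤ε : 0# ≤ ε) {m : Marginals n} (m-stoch : Stochastic m) where

    -- For `bs` equal to 0 Markov's inequality has nothing to cancel; `f` is constant and a leaf
    -- makes no error.
    constant-tree : IsBs f 0 → ∃[ t ]
      𝔼 m (λ x → 𝟙 (disagree (eval t x) (f x))) ≤ 4 · ε × (∀ x → queries t x ℕ.≤ 0)
    constant-tree isBs = leaf b , (begin
      𝔼 m (λ x → 𝟙 (disagree b (f x)))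
        ≈⟨ 𝔼-cong m (λ x → ≈-reflexive (cong 𝟙 (trans
             (cong (disagree b) (bs≡0⇒constant isBs x _)) (disagree-refl b)))) ⟩
      𝔼 m (λ _ → 0#)
        ≈⟨ 𝔼-const m-stoch 0# ⟩
      0#
        ≈⟨ ·-zeroʳ 4 ⟨
      4 · 0#
        ≤⟨ ·-monoʳ-≤ 4 0≤ε ⟩
      4 · ε ∎) , λ _ → z≤n
      where
      open ≤-Reasoning ≤-poset
      b = f (replicate n false)

    -- The protocol needs one certificate for every `ρ` at once, so the doubly negated certificates
    -- are gathered by finite choice.
    ¬¬-tree : ∀ {corr} → IsCorr× ε f corr → ∀ bs → IsBs f bs → ¬ ¬ (∃[ t ]
      𝔼 m (λ x → 𝟙 (disagree (eval t x) (f x))) ≤ 4 · ε × (∀ x → queries t x ℕ.≤ 4 ℕ.* bs ℕ.* corr))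
    ¬¬-tree isCorr zero isBs no-tree = no-tree (constant-tree isBs)
    ¬¬-tree isCorr bs@(suc _) isBs no-tree =
      ¬¬-choice (λ ρ → ¬¬-certificate (condition-stochastic ρ m-stoch) f 0≤ε isCorr) λ certificate →
      let open Protocol f (cert m-stoch f certificate) (vote m-stoch f certificate) in
      no-tree (_ , protocol-error m-stoch f certificate isBs ,
        queries-protocol (proj₁ ∘ proj₂ ∘ proj₂ ∘ certificate) (4 ℕ.* bs) _ _)

  D≤4·corr·bs : ∀ (f : BoolFun n) {ε} → 0# ≤ ε → ∀ μ → IsProduct μ → ∀ {d corr bs} →
    IsD μ (4 · ε) f d → IsCorr× ε f corr → IsBs f bs → d ℕ.≤ 4 ℕ.* corr ℕ.* bs
  D≤4·corr·bs f {ε} 0≤ε μ (m , m-bounds , m-total , μ≈∏) {d} {corr} {bs} isD isCorr isBs =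
    decidable-stable (d ℕ.≤? _) λ d≰ → ¬¬-tree 0≤ε m-stoch isCorr bs isBs λ (t , err≤ , cheap) →
    d≰ (subst (d ℕ.≤_) rearrange
      (cheap-tree⇒D≤ μ (4 · ε) f isD t (computes-intro μ m m-stoch μ≈∏ f t err≤) cheap))
    where
    m-stoch : Stochastic m
    m-stoch = (λ i b → proj₁ (m-bounds i b)) , m-total
    rearrange : 4 ℕ.* bs ℕ.* corr ≡ 4 ℕ.* corr ℕ.* bs
    rearrange = trans (ℕₚ.*-assoc 4 bs corr)
      (trans (cong (4 ℕ.*_) (ℕₚ.*-comm bs corr)) (sym (ℕₚ.*-assoc 4 corr bs)))

theorem2 : ∀ c ℓ₁ ℓ₂ → ∃[ K ] (0 ℕ.< K ×
             ((F : OrderedField c ℓ₁ ℓ₂) →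
              let open OrderedField F
                  open Queries F
              in
              (n : ℕ) → 1 ℕ.≤ n →
              (f : BoolFun n) →
              (ε : Carrier) → 0# ≤ ε → 2 · ε < 1# →
              (μ : Distribution n) → IsProduct μ →
              (d corr bs : ℕ) →
              IsD μ (4 · ε) f d → IsCorr× ε f corr → IsBs f bs →
              d ℕ.≤ K ℕ.* corr ℕ.* bs))
-- The constant 4 is the number of rounds per unit of `bs`, each round reading at most `corr` bits.
theorem2 c ℓ₁ ℓ₂ = 4 , s≤s z≤n , λ F n _ f ε 0≤ε _ μ product d corr bs →
  Expectation.D≤4·corr·bs F f 0≤ε μ product
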